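{- For all integers $p,q,r$ with $2 \leq p \leq q \leq r$, except when $p=q=2$ and $r>2$, there exists a connected graph $G_{p,q,r}$ satisfying $\chi(G_{p,q,r}) = p$, $\chi_{L}(G_{p,q,r}) = q$, and $\chi_{NL}(G_{p,q,r}) = r$.
   Context: All graphs are finite and simple. $\chi(G)$ is the chromatic number. For a proper $k$-coloring $f$ of $G$ with color classes $S_1,\dots,S_k$, two vertices $x,y$ are metric-distinguished if $d(x,S_i)\neq d(y,S_i)$ for some $i$, where $d(x,S)=\min\{d(x,z): z\in S\}$ and $d$ is the shortest-path distance; $f$ is a locating $k$-coloring if any two distinct vertices are metric-distinguished. The locating chromatic number $\chi_L(G)$ is the minimum $k$ for which $G$ admits a locating $k$-coloring. For a vertex $x$, let $N_f(x)=\{f(y): y \text{ adjacent to } x\}$ (the set of color-neighbors of $x$). Two vertices $x,y$ are neighbor-distinguished if $f(x)\neq f(y)$ or $N_f(x)\neq N_f(y)$; $f$ is a neighbor-locating $k$-coloring if every two distinct vertices are neighbor-distinguished. The neighbor-locating chromatic number $\chi_{NL}(G)$ is the minimum $k$ for which $G$ admits a neighbor-locating $k$-coloring. -}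

module Defs where

open import Data.Nat using (ℕ; zero; suc; _≤_)
open import Data.Fin using (Fin)
open import Data.Bool using (Bool; true; false)
open import Data.Product using (Σ; ∃; _×_; _,_)
open import Relation.Binary.PropositionalEquality using (_≡_; _≢_)
open import Relation.Nullary using (¬_)
open import Data.Sum using (_⊎_)

record Graph : Set where
  field
    n      : ℕ
    adj    : Fin n → Fin n → Bool
    symm   : ∀ x y → adj x y ≡ adj y x
    irrefl : ∀ x → adj x x ≡ false

module _ (G : Graph) where
  open Graph G

  Adj : Fin n → Fin n → Set
  Adj x y = adj x y ≡ true

  data Walk : ℕ → Fin n → Fin n → Set where
    here : ∀ {x} → Walk zero x x
    step : ∀ {k x y z} → Adj x y → Walk k y z → Walk (suc k) x z

  Connected : Set
  Connected = ∀ x y → ∃ λ k → Walk k x y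

  Dist : Fin n → Fin n → ℕ → Set
  Dist x y k = Walk k x y × (∀ m → Walk m x y → k ≤ m)

  Proper : (k : ℕ) → (Fin n → Fin k) → Set
  Proper k f = ∀ x y → Adj x y → f x ≢ f y

  DistClass : {k : ℕ} → (Fin n → Fin k) → Fin n → Fin k → ℕ → Set
  DistClass f x i d =
    (Σ (Fin n) λ z → f z ≡ i × Walk d x z) ×
    (∀ z m → f z ≡ i → Walk m x z → d ≤ m)

  MetricDistinguished : {k : ℕ} → (Fin n → Fin k) → Fin n → Fin n → Set
  MetricDistinguished f x y =
    Σ _ λ i → Σ ℕ λ a → Σ ℕ λ b →
      DistClass f x i a × DistClass f y i b × a ≢ b

  Locating : (k : ℕ) → (Fin n → Fin k) → Set
  Locating k f = Proper k f × (∀ x y → x ≢ y → MetricDistinguished f x y)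

  ColorNbr : {k : ℕ} → (Fin n → Fin k) → Fin n → Fin k → Set
  ColorNbr f x c = Σ (Fin n) λ y → Adj x y × f y ≡ c

  NeighborDistinguished : {k : ℕ} → (Fin n → Fin k) → Fin n → Fin n → Set
  NeighborDistinguished f x y =
    f x ≢ f y ⊎ (¬ (∀ c → (ColorNbr f x c → ColorNbr f y c) × (ColorNbr f y c → ColorNbr f x c)))

  NeighborLocating : (k : ℕ) → (Fin n → Fin k) → Set
  NeighborLocating k f = Proper k f × (∀ x y → x ≢ y → NeighborDistinguished f x y)

  IsMinColors : (ℕ → Set) → ℕ → Set
  IsMinColors P k = P k × (∀ m → P m → k ≤ m)

  ChromaticNumber : ℕ → Set
  ChromaticNumber = IsMinColors (λ k → Σ (Fin n → Fin k) (Proper k))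

  LocatingChromaticNumber : ℕ → Set
  LocatingChromaticNumber = IsMinColors (λ k → Σ (Fin n → Fin k) (Locating k))

  NeighborLocatingChromaticNumber : ℕ → Set
  NeighborLocatingChromaticNumber =
    IsMinColors (λ k → Σ (Fin n → Fin k) (NeighborLocating k))

{-# OPTIONS --safe #-}
module Submission where

-- In a complete multipartite graph with p parts and q vertices any two vertices are adjacent or
-- twins, so χ = p and χ_L = χ_NL = q. To raise χ_NL alone, let a path grow from a vertex adjacent to
-- all others. The twins survive, and old colors can be reused on the path because its vertices are
-- told apart by their distance to one color class; so χ and χ_L stay put. A new vertex raises χ_NL by
-- at most 1, and χ_NL is unbounded since k colors admit at most k 2^k pairs (f(x), N_f(x)); hence
-- χ_NL takes every value r > q along the way.

open import Defs
open import Data.Bool using (Bool; true; false; not)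
import Data.Bool.Properties as Bool
open import Data.Empty using (⊥-elim)
open import Data.Fin using (Fin; zero; suc; toℕ; fromℕ<; inject≤; combine; funToFin; finToFun)
open import Data.Fin.Properties
  using (_≟_; any?; all?; suc-injective; toℕ-injective; toℕ<n; toℕ-inject≤; inject≤-injective;
         fromℕ<-injective; combine-injective; finToFun-funToFin; ¬∀⟶∃¬; pigeonhole; injective⇒≤;
         <⇒≢)
open import Data.Nat using (ℕ; zero; suc; _≤_; _<_; _*_; _^_; _⊓_; z≤n; s≤s; s≤s⁻¹)
import Data.Nat.Properties as ℕ
open import Data.Product using (Σ; ∃; _×_; _,_; proj₁; proj₂)
open import Data.Sum using (_⊎_; inj₁; inj₂)
open import Function using (_∘_; id)
open import Relation.Binary.PropositionalEquality
  using (_≡_; _≢_; _≗_; refl; sym; trans; cong; ≢-sym)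
open import Relation.Nullary using (¬_; Dec; yes; no; does; contradiction)
open import Relation.Nullary.Decidable
  using (map′; dec-true; dec-false; decidable-stable; ¬?; _×-dec_; _⊎-dec_; _→-dec_)

-- Adjacency, color neighbors and walks

V : Graph → Set
V G = Fin (Graph.n G)

Adj-sym : ∀ G {x y} → Adj G x y → Adj G y x
Adj-sym G {x} {y} e = trans (Graph.symm G y x) e

Adj-irrefl : ∀ G {x} → ¬ Adj G x x
Adj-irrefl G {x} e with trans (sym e) (Graph.irrefl G x)
... | ()

Adj? : ∀ G x y → Dec (Adj G x y)
Adj? G x y = Graph.adj G x y Bool.≟ true

ColorNbr? : ∀ G {k} (f : V G → Fin k) x c → Dec (ColorNbr G f x c)
ColorNbr? G f x c = any? (λ y → Adj? G x y ×-dec (f y ≟ c))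

snoc : ∀ {G k x y z} → Walk G k x y → Adj G y z → Walk G (suc k) x z
snoc here         e = step e here
snoc (step e′ w) e = step e′ (snoc w e)

-- Distances to color classes

least : {P : ℕ → Set} → (∀ n → Dec (P n)) → ∀ n → P n → ∃ λ m → P m × (∀ j → P j → m ≤ j)
least P? zero pn = zero , pn , λ _ _ → z≤n
least {P} P? (suc n) pn with P? zero
... | yes p₀ = zero , p₀ , λ _ _ → z≤n
... | no ¬p₀ with least (P? ∘ suc) n pn
...   | m , pm , min = suc m , pm , minimal
  where
  minimal : ∀ j → P j → suc m ≤ j
  minimal zero    pj = contradiction pj ¬p₀
  minimal (suc j) pj = s≤s (min j pj)

reach? : ∀ G {k} (f : V G → Fin k) i d x → Dec (Σ (V G) λ z → f z ≡ i × Walk G d x z)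
reach? G f i zero x = map′ (λ e → x , e , here) (λ { (_ , e , here) → e }) (f x ≟ i)
reach? G f i (suc d) x =
  map′ (λ { (y , a , z , e , w) → z , e , step a w })
       (λ { (z , e , step a w) → _ , a , z , e , w })
       (any? (λ y → Adj? G x y ×-dec reach? G f i d y))

-- The class is named by a member `z` because an empty class has no distance. Connectedness gives a
-- walk to `z`, whose length bounds the search.
distClass : ∀ G {k} (f : V G → Fin k) → Connected G → ∀ x z → ∃ (DistClass G f x (f z))
distClass G f conn x z
  with least (λ d → reach? G f (f z) d x) (proj₁ (conn x z)) (z , refl , proj₂ (conn x z))
... | d , near , min = d , near , λ z′ m e w → min m (z′ , e , w)

distClass-zero : ∀ G {k} {f : V G → Fin k} {x i} → f x ≡ i → DistClass G f x i 0
distClass-zero G e = (_ , e , here) , λ _ _ _ _ → z≤n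

distClass-one : ∀ G {k} {f : V G → Fin k} {x i} → f x ≢ i → ColorNbr G f x i → DistClass G f x i 1
distClass-one G {f = f} {x} {i} x∉i (y , a , e) = (y , e , step a here) , minimal
  where
  minimal : ∀ z m → f z ≡ i → Walk G m x z → 1 ≤ m
  minimal z zero    e′ here = contradiction e′ x∉i
  minimal z (suc m) e′ w    = s≤s z≤n

MetricDistinguished-sym : ∀ G {k} {f : V G → Fin k} {x y} →
  MetricDistinguished G f x y → MetricDistinguished G f y x
MetricDistinguished-sym G (i , a , b , da , db , a≢b) = i , b , a , db , da , ≢-sym a≢b

-- Neighbor-locating colorings

NeighborDistinguished-sym : ∀ G {k} (f : V G → Fin k) x y →
  NeighborDistinguished G f x y → NeighborDistinguished G f y x
NeighborDistinguished-sym G f x y (inj₁ fx≢fy) = inj₁ (≢-sym fx≢fy)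
NeighborDistinguished-sym G f x y (inj₂ differ) =
  inj₂ (λ same → differ (λ c → proj₂ (same c) , proj₁ (same c)))

differAt : ∀ G {k} (f : V G → Fin k) x y c → ColorNbr G f x c → ¬ ColorNbr G f y c →
  NeighborDistinguished G f x y
differAt G f x y c x∼c y≁c = inj₂ (λ same → y≁c (proj₁ (same c) x∼c))

-- Properness keeps `x` out of class `c`, so its distance to it is exactly 1; a distance 1 from `y`
-- would be an edge into the class.
metricDifferAt : ∀ G {k} (f : V G → Fin k) → Connected G → Proper G k f → ∀ {x y} c →
  f x ≡ f y → ColorNbr G f x c → ¬ ColorNbr G f y c → MetricDistinguished G f x y
metricDifferAt G f conn proper {x} {y} c fx≡fy x∼c@(z , a , refl) y≁c
  with distClass G f conn y z
... | b , dy = c , 1 , b , distClass-one G (proper x z a) x∼c , dy , 1≢b dy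
  where
  1≢b : ∀ {b} → DistClass G f y c b → 1 ≢ b
  1≢b ((z′ , e , step a′ here) , _) refl = y≁c (z′ , a′ , e)

-- This gives `χ_L ≤ χ_NL`. If the colors differ, only `x` is at distance 0 from its own class; if
-- they agree, a color seen by just one of the two vertices separates them.
neighborLocating⇒locating : ∀ G {k} {f : V G → Fin k} → Connected G →
  NeighborLocating G k f → Locating G k f
neighborLocating⇒locating G {k} {f} conn (proper , nd) = proper , metric
  where
  metric : ∀ x y → x ≢ y → MetricDistinguished G f x y
  metric x y x≢y with f x ≟ f y | nd x y x≢y
  ... | no fx≢fy | _ with distClass G f conn y x
  ...   | b , dy = f x , 0 , b , distClass-zero G refl , dy , 0≢b dy
    where
    0≢b : ∀ {b} → DistClass G f y (f x) b → 0 ≢ b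
    0≢b ((_ , e , here) , _) refl = fx≢fy (sym e)
  metric x y x≢y | yes fx≡fy | inj₁ fx≢fy = contradiction fx≡fy fx≢fy
  metric x y x≢y | yes fx≡fy | inj₂ differ
    -- `differ` is only a negated universal; with finitely many colors and decidable color
    -- neighbors, an actual color can be extracted from it.
    with ¬∀⟶∃¬ k _ (λ c → (ColorNbr? G f x c →-dec ColorNbr? G f y c) ×-dec
                           (ColorNbr? G f y c →-dec ColorNbr? G f x c)) differ
  ... | c , ¬iff with ColorNbr? G f x c | ColorNbr? G f y c
  ...   | yes p | no ¬q = metricDifferAt G f conn proper c fx≡fy p ¬q
  ...   | no ¬p | yes q =
    MetricDistinguished-sym G (metricDifferAt G f conn proper c (sym fx≡fy) q ¬p)
  ...   | yes p | yes q = contradiction ((λ _ → q) , (λ _ → p)) ¬iff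
  ...   | no ¬p | no ¬q = contradiction ((⊥-elim ∘ ¬p) , (⊥-elim ∘ ¬q)) ¬iff

-- Neighbor-locating colorability: decidability, monotonicity, size bound

NLColorable : Graph → ℕ → Set
NLColorable G k = Σ (V G → Fin k) (NeighborLocating G k)

neighborLocating? : ∀ G k f → Dec (NeighborLocating G k f)
neighborLocating? G k f =
  all? (λ x → all? (λ y → Adj? G x y →-dec ¬? (f x ≟ f y)))
  ×-dec
  all? (λ x → all? (λ y → ¬? (x ≟ y) →-dec (¬? (f x ≟ f y) ⊎-dec
    ¬? (all? (λ c → (ColorNbr? G f x c →-dec ColorNbr? G f y c) ×-dec
                     (ColorNbr? G f y c →-dec ColorNbr? G f x c))))))

neighborLocating-cong : ∀ G {k} {f g : V G → Fin k} → f ≗ g →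
  NeighborLocating G k f → NeighborLocating G k g
neighborLocating-cong G {k} {f} {g} f≗g (proper , nd) =
  (λ x y a gx≡gy → proper x y a (trans (f≗g x) (trans gx≡gy (sym (f≗g y))))) ,
  λ x y x≢y → transfer (nd x y x≢y)
  where
  to : ∀ {x c} → ColorNbr G f x c → ColorNbr G g x c
  to (y , a , e) = y , a , trans (sym (f≗g y)) e
  from : ∀ {x c} → ColorNbr G g x c → ColorNbr G f x c
  from (y , a , e) = y , a , trans (f≗g y) e
  transfer : ∀ {x y} → NeighborDistinguished G f x y → NeighborDistinguished G g x y
  transfer {x} {y} (inj₁ fx≢fy) =
    inj₁ (λ gx≡gy → fx≢fy (trans (f≗g x) (trans gx≡gy (sym (f≗g y)))))
  transfer (inj₂ differ) =
    inj₂ (λ same → differ (λ c → from ∘ proj₁ (same c) ∘ to , from ∘ proj₂ (same c) ∘ to))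

-- Needed to locate the stage at which the tail first forces a new color. Colorings are enumerated
-- by codes; decoding is inverse to coding only pointwise, which `neighborLocating-cong` absorbs.
NLColorable? : ∀ G k → Dec (NLColorable G k)
NLColorable? G k =
  map′ (λ { (code , nl) → finToFun code , nl })
       (λ { (f , nl) → funToFin f , neighborLocating-cong G (sym ∘ finToFun-funToFin f) nl })
       (any? (λ code → neighborLocating? G k (finToFun code)))

NLColorable-mono : ∀ G {k l} → k ≤ l → NLColorable G k → NLColorable G l
NLColorable-mono G {k} {l} k≤l (f , proper , nd) =
  g , (λ x y a → proper x y a ∘ ι-injective) , λ x y x≢y → transfer (nd x y x≢y)
  where
  g : V G → Fin l
  g x = inject≤ (f x) k≤l
  ι-injective : ∀ {c d} → inject≤ c k≤l ≡ inject≤ d k≤l → c ≡ d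
  ι-injective = inject≤-injective k≤l k≤l _ _
  to : ∀ {x c} → ColorNbr G f x c → ColorNbr G g x (inject≤ c k≤l)
  to (y , a , e) = y , a , cong (λ c → inject≤ c k≤l) e
  from : ∀ {x c} → ColorNbr G g x (inject≤ c k≤l) → ColorNbr G f x c
  from (y , a , e) = y , a , ι-injective e
  transfer : ∀ {x y} → NeighborDistinguished G f x y → NeighborDistinguished G g x y
  transfer (inj₁ fx≢fy) = inj₁ (fx≢fy ∘ ι-injective)
  transfer (inj₂ differ) = inj₂ (λ same → differ (λ c →
    from ∘ proj₁ (same (inject≤ c k≤l)) ∘ to , from ∘ proj₂ (same (inject≤ c k≤l)) ∘ to))

-- One binary digit of `N_f(x)` as a subset of the `k` colors, so that the whole neighborhood is
-- coded in `Fin (2 ^ k)`.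
bit : ∀ {P : Set} → Dec P → Fin 2
bit (yes _) = suc zero
bit (no _)  = zero

bit-transport : ∀ {P Q : Set} (P? : Dec P) (Q? : Dec Q) → bit P? ≡ bit Q? → P → Q
bit-transport _       (yes q) _ _ = q
bit-transport (no ¬p) (no _)  _ p = contradiction p ¬p
bit-transport (yes _) (no _)  ()

¬NLColorable-large : ∀ G k → k * 2 ^ k < Graph.n G → ¬ NLColorable G k
¬NLColorable-large G k large (f , _ , nd) with pigeonhole large signature
  where
  nbrCode : V G → Fin (2 ^ k)
  nbrCode x = funToFin (λ c → bit (ColorNbr? G f x c))
  signature : V G → Fin (k * 2 ^ k)
  signature x = combine (f x) (nbrCode x)
... | x , y , x<y , eq with combine-injective (f x) _ (f y) _ eq | nd x y (<⇒≢ x<y)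
...   | fx≡fy , _ | inj₁ fx≢fy = fx≢fy fx≡fy
...   | _ , codes | inj₂ differ = differ (λ c →
  bit-transport (ColorNbr? G f x c) (ColorNbr? G f y c) (bits c) ,
  bit-transport (ColorNbr? G f y c) (ColorNbr? G f x c) (sym (bits c)))
  where
  bits : ∀ c → bit (ColorNbr? G f x c) ≡ bit (ColorNbr? G f y c)
  bits c = trans (sym (finToFun-funToFin (λ c → bit (ColorNbr? G f x c)) c))
             (trans (cong (λ i → finToFun i c) codes)
                    (finToFun-funToFin (λ c → bit (ColorNbr? G f y c)) c))

-- Attaching a pendant vertex

pendant : (G : Graph) → V G → Graph
pendant G t = record { n = suc (Graph.n G) ; adj = adj ; symm = symm ; irrefl = irrefl }
  where
  adj : Fin (suc (Graph.n G)) → Fin (suc (Graph.n G)) → Bool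
  adj zero    zero    = false
  adj zero    (suc y) = does (y ≟ t)
  adj (suc x) zero    = does (x ≟ t)
  adj (suc x) (suc y) = Graph.adj G x y
  symm : ∀ x y → adj x y ≡ adj y x
  symm zero    zero    = refl
  symm zero    (suc _) = refl
  symm (suc _) zero    = refl
  symm (suc x) (suc y) = Graph.symm G x y
  irrefl : ∀ x → adj x x ≡ false
  irrefl zero    = refl
  irrefl (suc x) = Graph.irrefl G x

does-≟⇒≡ : ∀ {n} {x y : Fin n} → does (x ≟ y) ≡ true → x ≡ y
does-≟⇒≡ {x = x} {y} e with x ≟ y | e
... | yes x≡y | _ = x≡y
... | no _    | ()

does-≟-refl : ∀ {n} (x : Fin n) → does (x ≟ x) ≡ true
does-≟-refl x with x ≟ x
... | yes _  = refl
... | no x≢x = contradiction refl x≢x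

-- The new vertex gets a fresh color. Old color neighborhoods can gain only that color, so they
-- still differ in the color in which they differed before.
NLColorable-pendant : ∀ G t {k} → NLColorable G k → NLColorable (pendant G t) (suc k)
NLColorable-pendant G t {k} (f , proper , nd) = g , g-proper , g-nd
  where
  G⁺ = pendant G t
  g : V G⁺ → Fin (suc k)
  g zero    = zero
  g (suc x) = suc (f x)
  g-proper : Proper G⁺ (suc k) g
  g-proper zero    zero    ()
  g-proper zero    (suc _) _ ()
  g-proper (suc _) zero    _ ()
  g-proper (suc x) (suc y) a e = proper x y a (suc-injective e)
  to : ∀ {x c} → ColorNbr G f x c → ColorNbr G⁺ g (suc x) (suc c)
  to (y , a , e) = suc y , a , cong suc e
  from : ∀ {x c} → ColorNbr G⁺ g (suc x) (suc c) → ColorNbr G f x c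
  from (suc y , a , e) = y , a , suc-injective e
  transfer : ∀ {x y} → NeighborDistinguished G f x y → NeighborDistinguished G⁺ g (suc x) (suc y)
  transfer (inj₁ fx≢fy) = inj₁ (fx≢fy ∘ suc-injective)
  transfer (inj₂ differ) = inj₂ (λ same → differ (λ c →
    from ∘ proj₁ (same (suc c)) ∘ to , from ∘ proj₂ (same (suc c)) ∘ to))
  g-nd : ∀ x y → x ≢ y → NeighborDistinguished G⁺ g x y
  g-nd zero    zero    x≢y = contradiction refl x≢y
  g-nd zero    (suc _) _   = inj₁ λ ()
  g-nd (suc _) zero    _   = inj₁ λ ()
  g-nd (suc x) (suc y) x≢y = transfer (nd x y (x≢y ∘ cong suc))

walk-pendant : ∀ G t {k x y} → Walk G k x y → Walk (pendant G t) k (suc x) (suc y)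
walk-pendant G t here       = here
walk-pendant G t (step a w) = step a (walk-pendant G t w)

connected-pendant : ∀ G t → Connected G → Connected (pendant G t)
connected-pendant G t conn zero zero = 0 , here
connected-pendant G t conn zero (suc y) =
  _ , step (does-≟-refl t) (walk-pendant G t (proj₂ (conn t y)))
connected-pendant G t conn (suc x) zero =
  _ , snoc (walk-pendant G t (proj₂ (conn x t))) (does-≟-refl t)
connected-pendant G t conn (suc x) (suc y) = _ , walk-pendant G t (proj₂ (conn x y))

-- Folding the new vertex onto a neighbor s of t retracts pendant G t onto G, so that pulling a
-- coloring back along the fold changes no distance from an old vertex to a color class.
module Fold (G : Graph) (t s : V G) (t∼s : Adj G t s) where

  fold : V (pendant G t) → V G
  fold zero    = s
  fold (suc x) = x

  fold-adj : ∀ x y → Adj (pendant G t) x y → Adj G (fold x) (fold y)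
  fold-adj zero    zero    ()
  fold-adj zero    (suc y) a with does-≟⇒≡ {x = y} {t} a
  ... | refl = Adj-sym G t∼s
  fold-adj (suc x) zero    a with does-≟⇒≡ {x = x} {t} a
  ... | refl = t∼s
  fold-adj (suc x) (suc y) a = a

  fold-walk : ∀ {k x y} → Walk (pendant G t) k x y → Walk G k (fold x) (fold y)
  fold-walk here               = here
  fold-walk (step {x = x} {y} a w) = step (fold-adj x y a) (fold-walk w)

  fold-proper : ∀ {k} {f : V G → Fin k} → Proper G k f → Proper (pendant G t) k (f ∘ fold)
  fold-proper proper x y a = proper (fold x) (fold y) (fold-adj x y a)

  fold-distClass : ∀ {k} {f : V G → Fin k} {x i d} →
    DistClass G f x i d → DistClass (pendant G t) (f ∘ fold) (suc x) i d
  fold-distClass ((z , e , w) , min) =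
    (suc z , e , walk-pendant G t w) , λ z′ m e′ w′ → min (fold z′) m e′ (fold-walk w′)

  -- Every nonempty walk from the new vertex passes through `t` first; `f s ≢ i` rules out the empty
  -- walk, since the new vertex copies the color of `s`.
  fold-distClass-new : ∀ {k} {f : V G → Fin k} {i d} → f s ≢ i →
    DistClass G f t i d → DistClass (pendant G t) (f ∘ fold) zero i (suc d)
  fold-distClass-new {f = f} {i} {d} s∉i ((z , e , w) , min) =
    (suc z , e , step (does-≟-refl t) (walk-pendant G t w)) , minimal
    where
    minimal : ∀ z m → f (fold z) ≡ i → Walk (pendant G t) m zero z → suc d ≤ m
    minimal z zero    e here = contradiction e s∉i
    minimal z (suc m) e (step {y = zero} () w)
    minimal z (suc m) e (step {y = suc y} a w) with does-≟⇒≡ {x = y} {t} a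
    ... | refl = s≤s (min (fold z) m e (fold-walk w))

-- Graphs with a growing tail

-- The next vertex is attached at `tip` and may copy the color of `stem`, so the tail can alternate
-- between two old colors.
record Tailed : Set where
  field
    graph    : Graph
    tip      : V graph
    stem     : V graph
    tip∼stem : Adj graph tip stem

open Tailed

extend : Tailed → Tailed
extend T = record
  { graph    = pendant (graph T) (tip T)
  ; tip      = zero
  ; stem     = suc (tip T)
  ; tip∼stem = does-≟-refl (tip T)
  }

extendBy : ℕ → Tailed → Tailed
extendBy zero    T = T
extendBy (suc m) T = extend (extendBy m T)

extendBy-size : ∀ m T → m ≤ Graph.n (graph (extendBy m T))
extendBy-size zero    T = z≤n
extendBy-size (suc m) T = s≤s (extendBy-size m T)

Twins : (G : Graph) → V G → V G → Set
Twins G x y = ∀ z → Graph.adj G x z ≡ Graph.adj G y z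

-- Growing the tail destroys a pair of twins only if one of them is the tip.
Locked : (T : Tailed) → V (graph T) → V (graph T) → Set
Locked T x y = Adj (graph T) x y ⊎ (Twins (graph T) x y × x ≢ tip T × y ≢ tip T)

-- What survives every extension: `coloring` and `clique` fix the chromatic number at `p`, while
-- `core` forces `q` colors on any locating coloring.
record Frame (p q : ℕ) (T : Tailed) : Set where
  field
    connected     : Connected (graph T)
    coloring      : Σ (V (graph T) → Fin p) (Proper (graph T) p)
    clique        : Fin p → V (graph T)
    clique-adj    : ∀ i j → i ≢ j → Adj (graph T) (clique i) (clique j)
    core          : Fin q → V (graph T)
    core-distinct : ∀ i j → i ≢ j → core i ≢ core j
    core-locked   : ∀ i j → i ≢ j → Locked T (core i) (core j)

-- The class colored far separates the tip, and every later tip, from all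
-- other vertices by distance.
record Stretched (q : ℕ) (T : Tailed) : Set where
  field
    coloring : V (graph T) → Fin q
    locating : Locating (graph T) q coloring
    far      : Fin q
    reach    : ℕ
    tip-far  : DistClass (graph T) coloring (tip T) far reach
    nearer   : ∀ x → ∃ λ d → DistClass (graph T) coloring x far d × d ≤ reach
    tip∉far  : coloring (tip T) ≢ far
    stem∉far : coloring (stem T) ≢ far

-- The new vertex is adjacent to the old tip alone, hence to neither twin. It also becomes the tip,
-- so the old vertices again avoid the tip.
extend-locked : ∀ T {x y} → Locked T x y → Locked (extend T) (suc x) (suc y)
extend-locked T (inj₁ a) = inj₁ a
extend-locked T {x} {y} (inj₂ (twins , x≢t , y≢t)) = inj₂ (twins⁺ , (λ ()) , λ ())
  where
  twins⁺ : Twins (graph (extend T)) (suc x) (suc y)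
  twins⁺ zero    = trans (dec-false (x ≟ tip T) x≢t) (sym (dec-false (y ≟ tip T) y≢t))
  twins⁺ (suc z) = twins z

extend-frame : ∀ {p q} T → Frame p q T → Frame p q (extend T)
extend-frame T F = record
  { connected     = connected-pendant (graph T) (tip T) connected
  ; coloring      = proj₁ coloring ∘ fold , fold-proper (proj₂ coloring)
  ; clique        = suc ∘ clique
  ; clique-adj    = clique-adj
  ; core          = suc ∘ core
  ; core-distinct = λ i j i≢j → core-distinct i j i≢j ∘ suc-injective
  ; core-locked   = λ i j i≢j → extend-locked T (core-locked i j i≢j)
  }
  where
  open Frame F
  open Fold (graph T) (tip T) (stem T) (tip∼stem T)

-- Old pairs keep their distances under the pulled-back coloring, and the new vertex is at distance
-- `suc reach` from `far`, beyond every old vertex.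
extend-stretched : ∀ {q} T → Stretched q T → Stretched q (extend T)
extend-stretched {q} T S = record
  { coloring = coloring ∘ fold
  ; locating = fold-proper (proj₁ locating) , metric
  ; far      = far
  ; reach    = suc reach
  ; tip-far  = fold-distClass-new stem∉far tip-far
  ; nearer   = nearer⁺
  -- The new tip has the color of the old stem and the new stem is the old tip, so the two
  -- conditions trade places.
  ; tip∉far  = stem∉far
  ; stem∉far = tip∉far
  }
  where
  open Stretched S
  open Fold (graph T) (tip T) (stem T) (tip∼stem T)
  G⁺ = graph (extend T)
  nearer⁺ : ∀ x → ∃ λ d → DistClass G⁺ (coloring ∘ fold) x far d × d ≤ suc reach
  nearer⁺ zero = suc reach , fold-distClass-new stem∉far tip-far , ℕ.≤-refl
  nearer⁺ (suc x) with nearer x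
  ... | d , dx , d≤r = d , fold-distClass dx , ℕ.m≤n⇒m≤1+n d≤r
  new-old : ∀ y → MetricDistinguished G⁺ (coloring ∘ fold) zero (suc y)
  new-old y with nearer y
  ... | d , dy , d≤r = far , suc reach , d , fold-distClass-new stem∉far tip-far ,
                       fold-distClass dy , ≢-sym (ℕ.<⇒≢ (s≤s d≤r))
  metric : ∀ x y → x ≢ y → MetricDistinguished G⁺ (coloring ∘ fold) x y
  metric zero    zero    x≢y = contradiction refl x≢y
  metric zero    (suc y) _   = new-old y
  metric (suc x) zero    _   = MetricDistinguished-sym G⁺ (new-old x)
  metric (suc x) (suc y) x≢y with proj₂ locating x y (x≢y ∘ cong suc)
  ... | i , a , b , dx , dy , a≢b = i , a , b , fold-distClass dx , fold-distClass dy , a≢b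

extendBy-frame : ∀ {p q} m T → Frame p q T → Frame p q (extendBy m T)
extendBy-frame zero    T F = F
extendBy-frame (suc m) T F = extend-frame (extendBy m T) (extendBy-frame m T F)

extendBy-stretched : ∀ {q} m T → Stretched q T → Stretched q (extendBy m T)
extendBy-stretched zero    T S = S
extendBy-stretched (suc m) T S = extend-stretched (extendBy m T) (extendBy-stretched m T S)

-- Lower bounds from cliques and twins

separating⇒≤ : ∀ {m n} (f : Fin m → Fin n) → (∀ i j → i ≢ j → f i ≢ f j) → m ≤ n
separating⇒≤ f sep =
  injective⇒≤ {f = f} (λ {i} {j} fi≡fj → decidable-stable (i ≟ j) (λ i≢j → sep i j i≢j fi≡fj))

-- A walk from `x` to the class is either empty, and then `y` lies in the class too, or its first
-- edge can be replaced by one from `y`.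
twins-distClass-≤ : ∀ G {k} {f : V G → Fin k} {x y i a b} → f x ≡ f y → Twins G x y →
  DistClass G f x i a → DistClass G f y i b → b ≤ a
twins-distClass-≤ G fx≡fy twins ((_ , e , here) , _) (_ , min) =
  min _ 0 (trans (sym fx≡fy) e) here
twins-distClass-≤ G fx≡fy twins ((z , e , step a w) , _) (_ , min) =
  min z _ e (step (trans (sym (twins _)) a) w)

twins-separated : ∀ G {k} {f : V G → Fin k} {x y} → Locating G k f → x ≢ y → Twins G x y →
  f x ≢ f y
twins-separated G {x = x} {y} (_ , metric) x≢y twins fx≡fy with metric x y x≢y
... | i , a , b , dx , dy , a≢b = a≢b (ℕ.≤-antisym
  (twins-distClass-≤ G (sym fx≡fy) (λ z → sym (twins z)) dy dx)
  (twins-distClass-≤ G fx≡fy twins dx dy))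

frame-chromatic : ∀ {p q} T → Frame p q T → ChromaticNumber (graph T) p
frame-chromatic T F = coloring , λ { k (f , proper) →
  separating⇒≤ (f ∘ clique) (λ i j i≢j → proper _ _ (clique-adj i j i≢j)) }
  where open Frame F

-- Core vertices get pairwise different colors: adjacent ones by properness, twins because with a
-- common color they would have equal distances to all classes.
frame-locating-≥ : ∀ {p q} T → Frame p q T → ∀ k → Σ _ (Locating (graph T) k) → q ≤ k
frame-locating-≥ {q = q} T F k (f , loc) = separating⇒≤ (f ∘ core) separated
  where
  open Frame F
  separated : ∀ i j → i ≢ j → f (core i) ≢ f (core j)
  separated i j i≢j with core-locked i j i≢j
  ... | inj₁ a = proj₁ loc _ _ a
  ... | inj₂ (twins , _) = twins-separated (graph T) loc (core-distinct i j i≢j) twins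

-- Attaining a prescribed neighbor-locating number

NLColorable-threshold : ∀ T k M → NLColorable (graph T) k → ¬ NLColorable (graph (extendBy M T)) k →
  ∃ λ m → NLColorable (graph (extendBy m T)) k × ¬ NLColorable (graph (extendBy (suc m) T)) k
NLColorable-threshold T k zero    yes₀ no-M = contradiction yes₀ no-M
NLColorable-threshold T k (suc M) yes₀ no-M with NLColorable? (graph (extendBy M T)) k
... | yes yes-M = M , yes-M , no-M
... | no no-M′  = NLColorable-threshold T k M yes₀ no-M′

Realizable : ℕ → ℕ → ℕ → Set
Realizable p q r = Σ Graph λ G → Connected G × ChromaticNumber G p ×
  LocatingChromaticNumber G q × NeighborLocatingChromaticNumber G r

realize-equal : ∀ {p q} T → Frame p q T → NLColorable (graph T) q → Realizable p q q
realize-equal T F (f , nl) =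
  graph T , connected , frame-chromatic T F ,
  ((f , neighborLocating⇒locating (graph T) connected nl) , frame-locating-≥ T F) ,
  ((f , nl) , λ { k (g , nl′) → frame-locating-≥ T F k
    (g , neighborLocating⇒locating (graph T) connected nl′) })
  where open Frame F

-- With `r = suc k`, the graph chosen is the first one past a `k`-colorable stage: `k` colors fail,
-- and the one added vertex costs only one more.
realize-above : ∀ {p q r} T → Frame p q T → Stretched q T → NLColorable (graph T) q → q < r →
  Realizable p q r
realize-above {r = suc k} T F S nl (s≤s q≤k)
  -- Since `q ≤ k`, the starting graph is `k`-colorable; after `suc (k * 2 ^ k)` extensions there
  -- are more vertices than signatures.
  with NLColorable-threshold T k (suc (k * 2 ^ k)) (NLColorable-mono (graph T) q≤k nl)
         (¬NLColorable-large (graph (extendBy (suc (k * 2 ^ k)) T)) k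
           (extendBy-size (suc (k * 2 ^ k)) T))
... | m , nl-m , ¬nl-1+m =
  graph T⁺ , Frame.connected F⁺ , frame-chromatic T⁺ F⁺ ,
  ((Stretched.coloring S⁺ , Stretched.locating S⁺) , frame-locating-≥ T⁺ F⁺) ,
  (NLColorable-pendant (graph (extendBy m T)) (tip (extendBy m T)) nl-m , λ l nl-l →
    ℕ.≰⇒> (λ l≤k → ¬nl-1+m (NLColorable-mono (graph T⁺) l≤k nl-l)))
  where
  T⁺ = extendBy (suc m) T
  F⁺ = extendBy-frame (suc m) T F
  S⁺ = extendBy-stretched (suc m) T S

-- Complete multipartite cores

multipartite : ∀ {n} → (Fin n → ℕ) → Graph
multipartite {n} π = record
  { n      = n
  ; adj    = λ x y → not (does (π x ℕ.≟ π y))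
  ; symm   = λ x y → cong not (does-sym (π x) (π y))
  ; irrefl = λ x → cong not (does-refl (π x))
  }
  where
  does-refl : ∀ a → does (a ℕ.≟ a) ≡ true
  does-refl zero    = refl
  does-refl (suc a) = does-refl a
  does-sym : ∀ a b → does (a ℕ.≟ b) ≡ does (b ℕ.≟ a)
  does-sym zero    zero    = refl
  does-sym zero    (suc _) = refl
  does-sym (suc _) zero    = refl
  does-sym (suc a) (suc b) = does-sym a b

-- The parts are {0}, …, {k − 1} and one part holding all remaining vertices.
multicore : (k q : ℕ) → Graph
multicore k q = multipartite {q} (λ x → k ⊓ toℕ x)

multicore-NLColorable : ∀ k q → NLColorable (multicore k q) q
multicore-NLColorable k q =
  id , (λ { x .x a refl → Adj-irrefl (multicore k q) a }) , λ _ _ → inj₁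

-- Vertex `zero` is a part of its own, so it is adjacent to all others and any of them can be the
-- stem.
tailedCore : (k q : ℕ) → Fin (suc q) → Tailed
tailedCore k q s = record
  { graph = multicore (suc k) (suc (suc q)) ; tip = zero ; stem = suc s ; tip∼stem = refl }

tailedCore-frame : ∀ k q s → k ≤ q → Frame (suc (suc k)) (suc (suc q)) (tailedCore k q s)
tailedCore-frame k q s k≤q = record
  { connected     = connected
  ; coloring      = color , proper
  ; clique        = ι
  ; clique-adj    = clique-adj
  ; core          = id
  ; core-distinct = λ _ _ → id
  ; core-locked   = locked
  }
  where
  G = multicore (suc k) (suc (suc q))
  part : V G → ℕ
  part x = suc k ⊓ toℕ x
  part-≢⇒adj : ∀ {x y} → part x ≢ part y → Adj G x y
  part-≢⇒adj {x} {y} ne = cong not (dec-false (part x ℕ.≟ part y) ne)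
  connected : Connected G
  connected zero    zero    = 0 , here
  connected zero    (suc y) = 1 , step refl here
  connected (suc x) zero    = 1 , step refl here
  connected (suc x) (suc y) = 2 , step {y = zero} refl (step refl here)
  color : V G → Fin (suc (suc k))
  color x = fromℕ< (s≤s (ℕ.m⊓n≤m (suc k) (toℕ x)))
  proper : Proper G (suc (suc k)) color
  proper x y a e
    with trans (sym a) (cong not (dec-true (part x ℕ.≟ part y) (fromℕ<-injective (part x) (part y)
           (s≤s (ℕ.m⊓n≤m (suc k) (toℕ x))) (s≤s (ℕ.m⊓n≤m (suc k) (toℕ y))) e)))
  ... | ()
  -- One vertex from each part: the singletons and the first vertex of the last part.
  ι : Fin (suc (suc k)) → V G
  ι i = inject≤ i (s≤s (s≤s k≤q))
  part-ι : ∀ i → part (ι i) ≡ toℕ i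
  part-ι i = trans (cong (suc k ⊓_) (toℕ-inject≤ i (s≤s (s≤s k≤q))))
                   (ℕ.m≥n⇒m⊓n≡n (s≤s⁻¹ (toℕ<n i)))
  clique-adj : ∀ i j → i ≢ j → Adj G (ι i) (ι j)
  clique-adj i j i≢j = part-≢⇒adj {ι i} {ι j} (λ e →
    i≢j (toℕ-injective (trans (sym (part-ι i)) (trans e (part-ι j)))))
  locked : ∀ x y → x ≢ y → Locked (tailedCore k q s) x y
  locked zero    zero    x≢y = contradiction refl x≢y
  -- The tip is adjacent to every other vertex, so all twins avoid it.
  locked zero    (suc y) _   = inj₁ refl
  locked (suc x) zero    _   = inj₁ refl
  locked (suc x) (suc y) _   with part (suc x) ℕ.≟ part (suc y)
  ... | yes same = inj₂ ((λ z → cong (λ a → not (does (a ℕ.≟ part z))) same) , (λ ()) , λ ())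
  ... | no ne    = inj₁ (part-≢⇒adj {suc x} {suc y} ne)

-- With at least three parts, vertex 1 is a singleton part as well. It is adjacent to all others, so
-- its class serves as `far`; the stem is vertex 2 in order to avoid it.
tailedCore-stretched : ∀ k q → suc k ≤ suc q →
  Stretched (suc (suc (suc q))) (tailedCore (suc k) (suc q) (suc zero))
tailedCore-stretched k q k≤q = record
  { coloring = id
  ; locating = neighborLocating⇒locating G connected
      (proj₂ (multicore-NLColorable (suc (suc k)) (suc (suc (suc q)))))
  ; far      = suc zero
  ; reach    = 1
  ; tip-far  = distClass-one G (λ ()) (suc zero , refl , refl)
  ; nearer   = nearer
  ; tip∉far  = λ ()
  ; stem∉far = λ ()
  }
  where
  G = multicore (suc (suc k)) (suc (suc (suc q)))
  open Frame (tailedCore-frame (suc k) (suc q) (suc zero) k≤q) using (connected)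
  nearer : ∀ x → ∃ λ d → DistClass G id x (suc zero) d × d ≤ 1
  nearer zero          = 1 , distClass-one G (λ ()) (suc zero , refl , refl) , ℕ.≤-refl
  nearer (suc zero)    = 0 , distClass-zero G refl , z≤n
  nearer (suc (suc x)) = 1 , distClass-one G (λ ()) (suc zero , refl , refl) , ℕ.≤-refl

-- For p = 2 a single tail vertex would only give a larger star, which needs q + 1 colors. With two of
-- them, the first shares color 1 with a leaf and is told apart by the color 2 of the second.
broom : ℕ → Tailed
broom q = extendBy 2 (tailedCore 0 (suc q) zero)

broom-frame : ∀ q → Frame 2 (suc (suc (suc q))) (broom q)
broom-frame q = extendBy-frame 2 _ (tailedCore-frame 0 (suc q) zero z≤n)

module Broom (q : ℕ) where

  B : Graph
  B = graph (broom q)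

  -- Vertex 0 is the tip, 1 the first tail vertex and 2 the center of the star; the rest are leaves.
  -- The original star keeps its pairwise distinct colors.
  color : V B → Fin (suc (suc (suc q)))
  color zero          = suc (suc zero)
  color (suc zero)    = suc zero
  color (suc (suc x)) = x

  proper : Proper B (suc (suc (suc q))) color
  proper zero             zero             ()
  proper zero             (suc zero)       _ ()
  proper zero             (suc (suc y))    ()
  proper (suc zero)       zero             _ ()
  proper (suc zero)       (suc zero)       ()
  proper (suc zero)       (suc (suc zero)) _ ()
  proper (suc zero)       (suc (suc (suc y))) ()
  proper (suc (suc x))    zero             ()
  proper (suc (suc zero)) (suc zero)       _ ()
  proper (suc (suc (suc x))) (suc zero)    ()
  proper (suc (suc x))    (suc (suc .x))   a refl = Adj-irrefl B {suc (suc x)} a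

  tip≁0 : ¬ ColorNbr B color zero zero
  tip≁0 (zero , () , _)
  tip≁0 (suc zero , _ , ())
  tip≁0 (suc (suc _) , () , _)

  leaf≁2 : ∀ x → ¬ ColorNbr B color (suc (suc (suc x))) (suc (suc zero))
  leaf≁2 x (zero , () , _)
  leaf≁2 x (suc zero , () , _)
  leaf≁2 x (suc (suc zero) , _ , ())
  leaf≁2 x (suc (suc (suc _)) , () , _)

  -- The tip shares color 2 with a leaf, but leaves see the center, which has color 0, and the tip
  -- does not.
  tip-old : ∀ y → zero ≢ suc y → NeighborDistinguished B color zero (suc y)
  tip-old zero          _ = inj₁ λ ()
  tip-old (suc zero)    _ = inj₁ λ ()
  tip-old (suc (suc y)) _ =
    NeighborDistinguished-sym B color (suc (suc (suc y))) zero
      (differAt B color (suc (suc (suc y))) zero zero (suc (suc zero) , refl , refl) tip≁0)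

  stem-old : ∀ y → NeighborDistinguished B color (suc zero) (suc (suc y))
  stem-old zero    = inj₁ λ ()
  stem-old (suc y) =
    differAt B color (suc zero) (suc (suc (suc y))) (suc (suc zero)) (zero , refl , refl) (leaf≁2 y)

  neighborLocating : NeighborLocating B (suc (suc (suc q))) color
  neighborLocating = proper , distinguished
    where
    distinguished : ∀ x y → x ≢ y → NeighborDistinguished B color x y
    distinguished zero          zero          x≢y = contradiction refl x≢y
    distinguished zero          (suc y)       x≢y = tip-old y x≢y
    distinguished (suc x)       zero          x≢y =
      NeighborDistinguished-sym B color zero (suc x) (tip-old x λ ())
    distinguished (suc zero)    (suc zero)    x≢y = contradiction refl x≢y
    distinguished (suc zero)    (suc (suc y)) x≢y = stem-old y
    distinguished (suc (suc x)) (suc zero)    x≢y =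
      NeighborDistinguished-sym B color (suc zero) (suc (suc x)) (stem-old x)
    distinguished (suc (suc x)) (suc (suc y)) x≢y = inj₁ (λ e → x≢y (cong (λ z → suc (suc z)) e))

  tip-far : DistClass B color zero zero 2
  tip-far = (suc (suc zero) , refl , step {y = suc zero} refl (step refl here)) , minimal
    where
    minimal : ∀ z m → color z ≡ zero → Walk B m zero z → 2 ≤ m
    minimal z _ () here
    minimal z _ e  (step {y = zero} () w)
    minimal z _ () (step {y = suc zero} a here)
    minimal z _ e  (step {y = suc zero} a (step _ _)) = s≤s (s≤s z≤n)
    minimal z _ e  (step {y = suc (suc _)} () w)

  stretched : Stretched (suc (suc (suc q))) (broom q)
  stretched = record
    { coloring = color
    ; locating = neighborLocating⇒locating B (Frame.connected (broom-frame q)) neighborLocating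
    -- Color 0 belongs to the center alone; only the tip is at distance 2 from it.
    ; far      = zero
    ; reach    = 2
    ; tip-far  = tip-far
    ; nearer   = nearer
    ; tip∉far  = λ ()
    ; stem∉far = λ ()
    }
    where
    nearer : ∀ x → ∃ λ d → DistClass B color x zero d × d ≤ 2
    nearer zero             = 2 , tip-far , ℕ.≤-refl
    nearer (suc zero)       =
      1 , distClass-one B (λ ()) (suc (suc zero) , refl , refl) , s≤s z≤n
    nearer (suc (suc zero)) = 0 , distClass-zero B refl , z≤n
    nearer (suc (suc (suc x))) =
      1 , distClass-one B (λ ()) (suc (suc zero) , refl , refl) , s≤s z≤n

theorem1 : (p q r : ℕ) → 2 ≤ p → p ≤ q → q ≤ r →
    ¬ (p ≡ 2 × q ≡ 2 × 2 < r) →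
    Σ Graph λ G → Connected G × ChromaticNumber G p ×
    LocatingChromaticNumber G q × NeighborLocatingChromaticNumber G r
theorem1 (suc (suc k)) (suc (suc l)) r (s≤s (s≤s z≤n)) (s≤s (s≤s k≤l)) q≤r ¬exception
  with ℕ.m≤n⇒m<n∨m≡n q≤r
-- For `q = r` no tail is grown: all `q` vertices of the core get different colors.
... | inj₂ refl =
  realize-equal _ (tailedCore-frame k l zero k≤l) (multicore-NLColorable (suc k) (suc (suc l)))
theorem1 (suc (suc zero)) (suc (suc zero)) r _ _ _ ¬exception | inj₁ q<r =
  contradiction (refl , refl , q<r) ¬exception
-- For `p = 2` the tip is the only singleton part that is certain to exist, so the broom replaces
-- the core as starting graph.
theorem1 (suc (suc zero)) (suc (suc (suc l))) r _ _ _ _ | inj₁ q<r =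
  realize-above (broom l) (broom-frame l) (Broom.stretched l)
    (Broom.color l , Broom.neighborLocating l) q<r
theorem1 (suc (suc (suc k))) (suc (suc (suc l))) r _ (s≤s (s≤s k≤l)) _ _ | inj₁ q<r =
  realize-above _ (tailedCore-frame (suc k) (suc l) (suc zero) k≤l)
    (tailedCore-stretched k l k≤l) (multicore-NLColorable (suc (suc k)) (suc (suc (suc l)))) q<r
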